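{- Provability in the sequent calculus $\mathsf{G4KM}$ is decidable: it is decidable, given a sequent $\Gamma\Rightarrow\Delta$, whether $\Gamma\Rightarrow\Delta$ is provable in $\mathsf{G4KM}$.
   Context: Let $\mathsf{Prop}$ be a countably infinite set of propositional variables with decidable equality. Formulas: $\varphi ::= p\in\mathsf{Prop}\mid\bot\mid\varphi\land\varphi\mid\varphi\lor\varphi\mid\varphi\to\varphi\mid\Box\varphi$. $\Gamma,\Delta,\dots$ denote finite multisets of formulas; $\Gamma,\Delta$ denotes multiset sum, and a formula is identified with the singleton multiset. $\Box^{ -1}\Gamma$ is the multiset obtained from $\Gamma$ by replacing each boxed formula $\Box\gamma$ by $\gamma$ (removing one outermost box) and keeping all formulas whose main connective is not $\Box$. A sequent is an expression $\Gamma\Rightarrow\Delta$ with $\Gamma,\Delta$ finite multisets of formulas. The calculus $\mathsf{G4KM}$ has the following rules ($p$ a propositional variable; premises before "/", conclusion after): - ($\bot$L): / $\Gamma,\bot\Rightarrow\Delta$ - (IdP): / $\Gamma,p\Rightarrow p,\Delta$ - ($\land$L): $\Gamma,\varphi,\psi\Rightarrow\Delta$ / $\Gamma,\varphi\land\psi\Rightarrow\Delta$ - ($\land$R): $\Gamma\Rightarrow\varphi,\Delta$ and $\Gamma\Rightarrow\psi,\Delta$ / $\Gamma\Rightarrow\varphi\land\psi,\Delta$ - ($\lor$L): $\Gamma,\varphi\Rightarrow\Delta$ and $\Gamma,\psi\Rightarrow\Delta$ / $\Gamma,\varphi\lor\psi\Rightarrow\Delta$ - ($\lor$R): $\Gamma\Rightarrow\varphi,\psi,\Delta$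 / $\Gamma\Rightarrow\varphi\lor\psi,\Delta$ - ($\land\!\to$L): $\Gamma,\varphi\to(\psi\to\chi)\Rightarrow\Delta$ / $\Gamma,(\varphi\land\psi)\to\chi\Rightarrow\Delta$ - ($\lor\!\to$L): $\Gamma,\varphi\to\chi,\psi\to\chi\Rightarrow\Delta$ / $\Gamma,(\varphi\lor\psi)\to\chi\Rightarrow\Delta$ - ($p\!\to$L): $\Gamma,p,\varphi\Rightarrow\Delta$ / $\Gamma,p,p\to\varphi\Rightarrow\Delta$ - ($\Box$R): $\Box^{ -1}\Gamma,\Box\varphi\Rightarrow\varphi$ / $\Gamma\Rightarrow\Box\varphi,\Delta$ - ($\Box\!\to$L): $\Box^{ -1}\Gamma,\Box\varphi,\psi\Rightarrow\varphi$ and $\Gamma,\psi\Rightarrow\Delta$ / $\Gamma,\Box\varphi\to\psi\Rightarrow\Delta$ - ($\to$R): $\Gamma,\varphi\Rightarrow\psi,\Delta$ and $\Box^{ -1}\Gamma,\varphi\Rightarrow\psi$ / $\Gamma\Rightarrow\varphi\to\psi,\Delta$ - ($\to\!\to$L): $\Gamma,\chi\to\psi,\varphi\Rightarrow\Delta,\chi$ and $\Box^{ -1}\Gamma,\chi\to\psi,\varphi\Rightarrow\chi$ and $\Gamma,\psi\Rightarrow\Delta$ / $\Gamma,(\varphi\to\chi)\to\psi\Rightarrow\Delta$ A sequent is provable if it is the root of a finite derivation tree built from these rules. -}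

module Defs where

open import Data.List.Base using (List; []; _∷_; map)
open import Data.List.Relation.Unary.All using (All)
open import Data.List.Relation.Binary.Permutation.Propositional using (_↭_)

infix  9 □_
infixr 8 _∧_
infixr 7 _∨_
infixr 6 _⊃_

-- _⊃_ is implication; the arrow _⇒_ is reserved for sequents.
data Formula (V : Set) : Set where
  var : V → Formula V
  ⊥   : Formula V
  _∧_ : Formula V → Formula V → Formula V
  _∨_ : Formula V → Formula V → Formula V
  _⊃_ : Formula V → Formula V → Formula V
  □_  : Formula V → Formula V

-- Finite multisets of formulas are represented by lists, with permutation _↭_
-- as equality.
Context : Set → Set
Context V = List (Formula V)

unbox : {V : Set} → Formula V → Formula V
unbox (□ φ)   = φ
unbox (var p) = var p
unbox ⊥       = ⊥
unbox (φ ∧ ψ) = φ ∧ ψ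
unbox (φ ∨ ψ) = φ ∨ ψ
unbox (φ ⊃ ψ) = φ ⊃ ψ

□⁻¹ : {V : Set} → Context V → Context V
□⁻¹ = map unbox

infix 4 _⇒_
record Sequent (V : Set) : Set where
  constructor _⇒_
  field
    antecedent : Context V
    succedent  : Context V

infix 3 _≈_
data _≈_ {V : Set} : Sequent V → Sequent V → Set where
  perm : {Γ Γ′ Δ Δ′ : Context V} → Γ ↭ Γ′ → Δ ↭ Δ′ → (Γ ⇒ Δ) ≈ (Γ′ ⇒ Δ′)

-- G4KM Ps S: the premises Ps and the conclusion S form a rule instance, with the
-- principal formulas displayed at the head of the list.
data G4KM {V : Set} : List (Sequent V) → Sequent V → Set where
  ⊥L  : ∀ {Γ Δ} →
        G4KM [] (⊥ ∷ Γ ⇒ Δ)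
  IdP : ∀ {Γ Δ p} →
        G4KM [] (var p ∷ Γ ⇒ var p ∷ Δ)
  ∧L  : ∀ {Γ Δ φ ψ} →
        G4KM ((φ ∷ ψ ∷ Γ ⇒ Δ) ∷ [])
             (φ ∧ ψ ∷ Γ ⇒ Δ)
  ∧R  : ∀ {Γ Δ φ ψ} →
        G4KM ((Γ ⇒ φ ∷ Δ) ∷ (Γ ⇒ ψ ∷ Δ) ∷ [])
             (Γ ⇒ φ ∧ ψ ∷ Δ)
  ∨L  : ∀ {Γ Δ φ ψ} →
        G4KM ((φ ∷ Γ ⇒ Δ) ∷ (ψ ∷ Γ ⇒ Δ) ∷ [])
             (φ ∨ ψ ∷ Γ ⇒ Δ)
  ∨R  : ∀ {Γ Δ φ ψ} →
        G4KM ((Γ ⇒ φ ∷ ψ ∷ Δ) ∷ [])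
             (Γ ⇒ φ ∨ ψ ∷ Δ)
  ∧→L : ∀ {Γ Δ φ ψ χ} →
        G4KM ((φ ⊃ (ψ ⊃ χ) ∷ Γ ⇒ Δ) ∷ [])
             ((φ ∧ ψ) ⊃ χ ∷ Γ ⇒ Δ)
  ∨→L : ∀ {Γ Δ φ ψ χ} →
        G4KM ((φ ⊃ χ ∷ ψ ⊃ χ ∷ Γ ⇒ Δ) ∷ [])
             ((φ ∨ ψ) ⊃ χ ∷ Γ ⇒ Δ)
  p→L : ∀ {Γ Δ p φ} →
        G4KM ((var p ∷ φ ∷ Γ ⇒ Δ) ∷ [])
             (var p ∷ var p ⊃ φ ∷ Γ ⇒ Δ)
  □R  : ∀ {Γ Δ φ} →
        G4KM ((□ φ ∷ □⁻¹ Γ ⇒ φ ∷ []) ∷ [])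
             (Γ ⇒ □ φ ∷ Δ)
  □→L : ∀ {Γ Δ φ ψ} →
        G4KM ((□ φ ∷ ψ ∷ □⁻¹ Γ ⇒ φ ∷ []) ∷ (ψ ∷ Γ ⇒ Δ) ∷ [])
             (□ φ ⊃ ψ ∷ Γ ⇒ Δ)
  →R  : ∀ {Γ Δ φ ψ} →
        G4KM ((φ ∷ Γ ⇒ ψ ∷ Δ) ∷ (φ ∷ □⁻¹ Γ ⇒ ψ ∷ []) ∷ [])
             (Γ ⇒ φ ⊃ ψ ∷ Δ)
  →→L : ∀ {Γ Δ φ χ ψ} →
        G4KM ((χ ⊃ ψ ∷ φ ∷ Γ ⇒ χ ∷ Δ) ∷ (χ ⊃ ψ ∷ φ ∷ □⁻¹ Γ ⇒ χ ∷ []) ∷ (ψ ∷ Γ ⇒ Δ) ∷ [])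
             ((φ ⊃ χ) ⊃ ψ ∷ Γ ⇒ Δ)

-- Since a sequent consists of multisets, a rule instance applies to every sequent
-- equal to its conclusion up to permutation.
data Provable {V : Set} (S : Sequent V) : Set where
  infer : ∀ {Ps S′} → S ≈ S′ → G4KM Ps S′ → All Provable Ps → Provable S

{-# OPTIONS --safe #-}

-- Backward proof search terminates.  Give formulas a weight that is multiplicative
-- in the connectives, and let formulas in the succedent count twice; then every
-- premise of a rule weighs less than the conclusion.  In (□R) the formula □φ moves
-- to the antecedent, and the double counting of the succedent pays for it.  Since a
-- sequent has finitely many permutations, each the conclusion of finitely many rule
-- instances, well-founded recursion on the weight decides provability.
module Submission where

open import Defs
open import Data.Empty using (⊥-elim)
open import Data.List.Base using (List; []; _∷_; _++_; [_]; map)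
open import Data.List.Membership.Propositional using (_∈_; lose)
open import Data.List.Membership.Propositional.Properties
  using (∈-++⁺ˡ; ∈-++⁺ʳ; ∈-∃++)
open import Data.List.Relation.Binary.Permutation.Propositional
  using (_↭_; ↭-refl; ↭-sym; ↭-trans; prep)
open import Data.List.Relation.Binary.Permutation.Propositional.Properties
  using (↭-empty-inv; ∈-resp-↭; drop-mid; shift; map⁺)
open import Data.List.Relation.Unary.All as All using (All; []; _∷_)
open import Data.List.Relation.Unary.Any using (Any; here; any?; satisfied)
open import Data.Nat.Base using (ℕ; suc; pred; _+_; _*_; _≤_; _<_; z≤n)
open import Data.Nat.Induction using (Acc; acc; <-wellFounded)
open import Data.Nat.ListAction using (sum)
open import Data.Nat.ListAction.Properties using (sum-↭)
open import Data.Nat.Properties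
  using (≤-refl; ≤-reflexive; ≤-<-trans; m≤m+n; m+n≤o⇒m≤o; +-mono-≤; +-monoʳ-≤;
    *-monoʳ-≤; _<?_)
open import Data.Nat.Tactic.RingSolver using (solve-∀)
open import Data.Product.Base using (∃; ∃₂; _×_; _,_; proj₂)
open import Data.Sum.Base using (_⊎_; inj₁; inj₂)
open import Function.Base using (_∘_)
open import Function.Bundles using (_↔_)
open import Relation.Binary.Definitions using (DecidableEquality)
open import Relation.Binary.PropositionalEquality
  using (_≡_; refl; cong; cong₂; sym; subst)
open import Relation.Nullary.Decidable using (Dec; yes; no; map′; _⊎-dec_)
open import Relation.Unary using (Decidable)

private
  variable
    A V : Set

-- Deciding existential statements over permutations

-- Either `x` goes in front, or the head `w` stays first and is absorbed into the predicate, which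
-- is why `P` must vary along the recursion.
insertion? : {P : List A → Set} → Decidable P → ∀ x xs →
  Dec (∃₂ λ ys zs → xs ≡ ys ++ zs × P (ys ++ x ∷ zs))
insertion? {P = P} P? x [] = map′ to from (P? [ x ])
  where
  to : P [ x ] → ∃₂ λ ys zs → [] ≡ ys ++ zs × P (ys ++ x ∷ zs)
  to p = [] , [] , refl , p
  from : (∃₂ λ ys zs → [] ≡ ys ++ zs × P (ys ++ x ∷ zs)) → P [ x ]
  from ([] , [] , refl , p) = p
insertion? {P = P} P? x (w ∷ ws) =
  map′ to from (P? (x ∷ w ∷ ws) ⊎-dec insertion? (P? ∘ (w ∷_)) x ws)
  where
  Inside = ∃₂ λ ys zs → ws ≡ ys ++ zs × P (w ∷ ys ++ x ∷ zs)
  Anywhere = ∃₂ λ ys zs → w ∷ ws ≡ ys ++ zs × P (ys ++ x ∷ zs)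
  to : P (x ∷ w ∷ ws) ⊎ Inside → Anywhere
  to (inj₁ p)                  = [] , w ∷ ws , refl , p
  to (inj₂ (ys , zs , eq , p)) = w ∷ ys , zs , cong (w ∷_) eq , p
  from : Anywhere → P (x ∷ w ∷ ws) ⊎ Inside
  from ([]     , zs , refl , p) = inj₁ p
  from (_ ∷ ys , zs , refl , p) = inj₂ (ys , zs , refl , p)

-- Every permutation of `x ∷ xs` arises by inserting `x` into a permutation of `xs`. The insertion
-- is folded into the predicate, so no list of permutations is ever built.
permutation? : {P : List A → Set} → Decidable P → ∀ xs →
  Dec (∃ λ ys → xs ↭ ys × P ys)
permutation? {P = P} P? [] = map′ to from (P? [])
  where
  to : P [] → ∃ λ ys → [] ↭ ys × P ys
  to p = [] , ↭-refl , p
  from : (∃ λ ys → [] ↭ ys × P ys) → P []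
  from (ys , []↭ys , p) = subst P (↭-empty-inv (↭-sym []↭ys)) p
permutation? {P = P} P? (x ∷ xs) =
  map′ to from (permutation? (insertion? P? x) xs)
  where
  Inserted = λ ws → ∃₂ λ ys zs → ws ≡ ys ++ zs × P (ys ++ x ∷ zs)
  to : (∃ λ ws → xs ↭ ws × Inserted ws) → ∃ λ ys → x ∷ xs ↭ ys × P ys
  to (_ , xs↭ws , ys , zs , refl , p) =
    ys ++ x ∷ zs , ↭-trans (prep x xs↭ws) (↭-sym (shift x ys zs)) , p
  from : (∃ λ ys → x ∷ xs ↭ ys × P ys) → ∃ λ ws → xs ↭ ws × Inserted ws
  -- Locate an occurrence of `x` in the permuted list; deleting it on both sides leaves a
  -- permutation of `xs`.
  from (_ , xxs↭ys , p) with ∈-∃++ (∈-resp-↭ xxs↭ys (here refl))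
  ... | ys , zs , refl = ys ++ zs , drop-mid [] ys xxs↭ys , ys , zs , refl , p

≈-search? : {P : Sequent V → Set} → Decidable P → ∀ S →
  Dec (∃ λ S′ → S ≈ S′ × P S′)
≈-search? P? (Γ ⇒ Δ) =
  map′ (λ (Γ′ , Γ↭Γ′ , Δ′ , Δ↭Δ′ , p) → (Γ′ ⇒ Δ′) , perm Γ↭Γ′ Δ↭Δ′ , p)
       (λ { ((Γ′ ⇒ Δ′) , perm Γ↭Γ′ Δ↭Δ′ , p) → Γ′ , Γ↭Γ′ , Δ′ , Δ↭Δ′ , p })
       (permutation? (λ Γ′ → permutation? (λ Δ′ → P? (Γ′ ⇒ Δ′)) Δ) Γ)

-- Enumerating the rule instances with a given conclusion

Inference : Sequent V → Set
Inference S = ∃ λ Ps → G4KM Ps S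

-- Principal formulas stand at the head, so the shape of the head formula fixes the instance and its
-- premises.
leftInferences : (Γ Δ : Context V) → List (Inference (Γ ⇒ Δ))
leftInferences (⊥ ∷ _)             _ = [ _ , ⊥L ]
leftInferences (_ ∧ _ ∷ _)         _ = [ _ , ∧L ]
leftInferences (_ ∨ _ ∷ _)         _ = [ _ , ∨L ]
leftInferences ((_ ∧ _) ⊃ _ ∷ _)   _ = [ _ , ∧→L ]
leftInferences ((_ ∨ _) ⊃ _ ∷ _)   _ = [ _ , ∨→L ]
leftInferences (□ _ ⊃ _ ∷ _)       _ = [ _ , □→L ]
leftInferences ((_ ⊃ _) ⊃ _ ∷ _)   _ = [ _ , →→L ]
-- A box or an implication from `⊥` is principal in no left rule. Variables and implications from
-- variables are left to `identities` and `detachments`.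
leftInferences _                   _ = []

rightInferences : (Γ Δ : Context V) → List (Inference (Γ ⇒ Δ))
rightInferences _ (_ ∧ _ ∷ _) = [ _ , ∧R ]
rightInferences _ (_ ∨ _ ∷ _) = [ _ , ∨R ]
rightInferences _ (_ ⊃ _ ∷ _) = [ _ , →R ]
rightInferences _ (□ _ ∷ _)   = [ _ , □R ]
rightInferences _ _           = []

module _ (_≟_ : DecidableEquality V) where

  -- `IdP` and `p→L` are the rules whose conclusion displays one variable twice; this is where
  -- equality of variables has to be decided.
  identities : (Γ Δ : Context V) → List (Inference (Γ ⇒ Δ))
  identities (var p ∷ _) (var q ∷ _) with p ≟ q
  ... | yes refl = [ _ , IdP ]
  ... | no _     = []
  identities _ _ = []

  detachments : (Γ Δ : Context V) → List (Inference (Γ ⇒ Δ))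
  detachments (var p ∷ var q ⊃ _ ∷ _) _ with p ≟ q
  ... | yes refl = [ _ , p→L ]
  ... | no _     = []
  detachments _ _ = []

  inferences : (S : Sequent V) → List (Inference S)
  inferences (Γ ⇒ Δ) =
    leftInferences Γ Δ ++ rightInferences Γ Δ ++ identities Γ Δ ++ detachments Γ Δ

  inferences-complete : ∀ {Ps S} (r : G4KM Ps S) → (Ps , r) ∈ inferences S
  inferences-complete = complete
    where
    L = leftInferences
    R = rightInferences
    I = identities

    left : ∀ {Γ Δ r} → r ∈ L Γ Δ → r ∈ inferences (Γ ⇒ Δ)
    left = ∈-++⁺ˡ

    right : ∀ {Γ Δ r} → r ∈ R Γ Δ → r ∈ inferences (Γ ⇒ Δ)
    right {Γ} {Δ} = ∈-++⁺ʳ (L Γ Δ) ∘ ∈-++⁺ˡ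

    identity : ∀ {Γ Δ r} → r ∈ I Γ Δ → r ∈ inferences (Γ ⇒ Δ)
    identity {Γ} {Δ} = ∈-++⁺ʳ (L Γ Δ) ∘ ∈-++⁺ʳ (R Γ Δ) ∘ ∈-++⁺ˡ

    detachment : ∀ {Γ Δ r} → r ∈ detachments Γ Δ → r ∈ inferences (Γ ⇒ Δ)
    detachment {Γ} {Δ} = ∈-++⁺ʳ (L Γ Δ) ∘ ∈-++⁺ʳ (R Γ Δ) ∘ ∈-++⁺ʳ (I Γ Δ)

    IdP∈ : ∀ {Γ Δ p} → (_ , IdP) ∈ identities (var p ∷ Γ) (var p ∷ Δ)
    IdP∈ {p = p} with p ≟ p
    ... | yes refl = here refl
    ... | no p≢p   = ⊥-elim (p≢p refl)

    p→L∈ : ∀ {Γ Δ p φ} → (_ , p→L) ∈ detachments (var p ∷ var p ⊃ φ ∷ Γ) Δ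
    p→L∈ {p = p} with p ≟ p
    ... | yes refl = here refl
    ... | no p≢p   = ⊥-elim (p≢p refl)

    complete : ∀ {Ps S} (r : G4KM Ps S) → (Ps , r) ∈ inferences S
    complete ⊥L  = left (here refl)
    complete IdP = identity IdP∈
    complete ∧L  = left (here refl)
    complete ∧R  = right (here refl)
    complete ∨L  = left (here refl)
    complete ∨R  = right (here refl)
    complete ∧→L = left (here refl)
    complete ∨→L = left (here refl)
    complete p→L = detachment p→L∈
    complete □R  = right (here refl)
    complete □→L = left (here refl)
    complete →R  = right (here refl)
    complete →→L = left (here refl)

  inference? : {P : Sequent V → Set} → Decidable P → ∀ S →
    Dec (∃ λ Ps → G4KM Ps S × All P Ps)
  inference? {P = P} P? S = map′ to from (any? holds? (inferences S))
    where
    Holds : Inference S → Set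
    Holds (Ps , _) = All P Ps

    holds? : Decidable Holds
    holds? (Ps , _) = All.all? P? Ps

    to : Any Holds (inferences S) → ∃ λ Ps → G4KM Ps S × All P Ps
    to found = let (Ps , r) , ps = satisfied found in Ps , r , ps

    from : (∃ λ Ps → G4KM Ps S × All P Ps) → Any Holds (inferences S)
    from (_ , r , ps) = lose (inferences-complete r) ps

-- The weight and its descent along the rules

-- The weight is positive, and is defined through its predecessor so that this
-- holds by computation: for instance weight (φ ∧ ψ) is definitionally
-- 4 * (weight φ * weight ψ).
weight excess : Formula V → ℕ
weight φ = suc (excess φ)
excess (var _) = 0
excess ⊥       = 0
excess (φ ∧ ψ) = pred (4 * (weight φ * weight ψ))
excess (φ ∨ ψ) = pred (3 * (weight φ * weight ψ))
excess (φ ⊃ ψ) = pred (3 * (weight φ * weight ψ))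
excess (□ φ)   = pred (3 * weight φ)

total : Context V → ℕ
total Γ = sum (map weight Γ)

size : Sequent V → ℕ
size (Γ ⇒ Δ) = total Γ + 2 * total Δ

size-≈ : {S S′ : Sequent V} → S ≈ S′ → size S ≡ size S′
size-≈ (perm Γ↭Γ′ Δ↭Δ′) =
  cong₂ (λ l r → l + 2 * r) (sum-↭ (map⁺ weight Γ↭Γ′)) (sum-↭ (map⁺ weight Δ↭Δ′))

weight-unbox : (φ : Formula V) → weight (unbox φ) ≤ weight φ
weight-unbox (□ φ)   = m≤m+n (weight φ) (2 * weight φ)
weight-unbox (var _) = ≤-refl
weight-unbox ⊥       = ≤-refl
weight-unbox (_ ∧ _) = ≤-refl
weight-unbox (_ ∨ _) = ≤-refl
weight-unbox (_ ⊃ _) = ≤-refl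

total-□⁻¹ : (Γ : Context V) → total (□⁻¹ Γ) ≤ total Γ
total-□⁻¹ []      = ≤-refl
total-□⁻¹ (φ ∷ Γ) = +-mono-≤ (weight-unbox φ) (total-□⁻¹ Γ)

total-++-□⁻¹ : (Θ Γ : Context V) → total (Θ ++ □⁻¹ Γ) ≤ total (Θ ++ Γ)
total-++-□⁻¹ []      Γ = total-□⁻¹ Γ
total-++-□⁻¹ (φ ∷ Θ) Γ = +-monoʳ-≤ (weight φ) (total-++-□⁻¹ Θ Γ)

-- Unboxing `Γ` and discarding `Δ` never add weight, so a modal premise may be estimated by its
-- counterpart with `Γ` and `Δ` intact. In `→R` and `→→L` that counterpart is the first premise, and
-- one balance serves both.
modal-≤ : (Θ : Context V) (φ : Formula V) (Γ Δ : Context V) →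
  size (Θ ++ □⁻¹ Γ ⇒ [ φ ]) ≤ size (Θ ++ Γ ⇒ φ ∷ Δ)
modal-≤ Θ φ Γ Δ =
  +-mono-≤ (total-++-□⁻¹ Θ Γ) (*-monoʳ-≤ 2 (+-monoʳ-≤ (weight φ) z≤n))

-- Turns a strict inequality into a polynomial identity with explicit remainder `k`, a form the ring
-- solver can prove.
slack : ∀ {m n k} → suc m + k ≡ n → m < n
slack eq = m+n≤o⇒m≤o _ (≤-reflexive eq)

-- In the following identities suc x, suc y, suc z are the weights of the components
-- of the principal formula, from left to right (a variable weighs 1), and g, d are
-- those of the side contexts; the remainder is what the premise lacks.
∧L-balance : ∀ x y g d →
  suc ((suc x + (suc y + g)) + 2 * d) + (4 * x * y + 3 * x + 3 * y + 1)
  ≡ (4 * (suc x * suc y) + g) + 2 * d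
∧L-balance = solve-∀

∧R₁-balance : ∀ x y g d →
  suc (g + 2 * (suc x + d)) + (8 * x * y + 6 * x + 8 * y + 5)
  ≡ g + 2 * (4 * (suc x * suc y) + d)
∧R₁-balance = solve-∀

∧R₂-balance : ∀ x y g d →
  suc (g + 2 * (suc y + d)) + (8 * x * y + 8 * x + 6 * y + 5)
  ≡ g + 2 * (4 * (suc x * suc y) + d)
∧R₂-balance = solve-∀

∨L₁-balance : ∀ x y g d →
  suc ((suc x + g) + 2 * d) + (3 * x * y + 2 * x + 3 * y + 1)
  ≡ (3 * (suc x * suc y) + g) + 2 * d
∨L₁-balance = solve-∀

∨L₂-balance : ∀ x y g d →
  suc ((suc y + g) + 2 * d) + (3 * x * y + 3 * x + 2 * y + 1)
  ≡ (3 * (suc x * suc y) + g) + 2 * d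
∨L₂-balance = solve-∀

∨R-balance : ∀ x y g d →
  suc (g + 2 * (suc x + (suc y + d))) + (6 * x * y + 4 * x + 4 * y + 1)
  ≡ g + 2 * (3 * (suc x * suc y) + d)
∨R-balance = solve-∀

∧→L-balance : ∀ x y z g d →
  suc ((3 * (suc x * (3 * (suc y * suc z))) + g) + 2 * d)
    + (3 * x * y * z + 3 * x * y + 3 * x * z + 3 * y * z
       + 3 * x + 3 * y + 3 * z + 2)
  ≡ (3 * ((4 * (suc x * suc y)) * suc z) + g) + 2 * d
∧→L-balance = solve-∀

∨→L-balance : ∀ x y z g d →
  suc ((3 * (suc x * suc z) + (3 * (suc y * suc z) + g)) + 2 * d)
    + (9 * x * y * z + 9 * x * y + 6 * x * z + 6 * y * z
       + 6 * x + 6 * y + 3 * z + 2)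
  ≡ (3 * ((3 * (suc x * suc y)) * suc z) + g) + 2 * d
∨→L-balance = solve-∀

p→L-balance : ∀ x g d →
  suc ((1 + (suc x + g)) + 2 * d) + (2 * x + 1)
  ≡ (1 + (3 * (1 * suc x) + g)) + 2 * d
p→L-balance = solve-∀

□R-balance : ∀ x g d →
  suc ((3 * suc x + g) + 2 * (suc x + d)) + x
  ≡ g + 2 * (3 * suc x + d)
□R-balance = solve-∀

□→L₁-balance : ∀ x y g d →
  suc ((3 * suc x + (suc y + g)) + 2 * (suc x + d)) + (9 * x * y + 4 * x + 8 * y + 2)
  ≡ (3 * ((3 * suc x) * suc y) + g) + 2 * d
□→L₁-balance = solve-∀

□→L₂-balance : ∀ x y g d →
  suc ((suc y + g) + 2 * d) + (9 * x * y + 9 * x + 8 * y + 7)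
  ≡ (3 * ((3 * suc x) * suc y) + g) + 2 * d
□→L₂-balance = solve-∀

→R-balance : ∀ x y g d →
  suc ((suc x + g) + 2 * (suc y + d)) + (6 * x * y + 5 * x + 4 * y + 2)
  ≡ g + 2 * (3 * (suc x * suc y) + d)
→R-balance = solve-∀

→→L₁-balance : ∀ x y z g d →
  suc ((3 * (suc y * suc z) + (suc x + g)) + 2 * (suc y + d))
    + (9 * x * y * z + 9 * x * y + 9 * x * z + 6 * y * z
       + 8 * x + 4 * y + 6 * z + 2)
  ≡ (3 * ((3 * (suc x * suc y)) * suc z) + g) + 2 * d
→→L₁-balance = solve-∀

→→L₃-balance : ∀ x y z g d →
  suc ((suc z + g) + 2 * d)
    + (9 * x * y * z + 9 * x * y + 9 * x * z + 9 * y * z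
       + 9 * x + 9 * y + 8 * z + 7)
  ≡ (3 * ((3 * (suc x * suc y)) * suc z) + g) + 2 * d
→→L₃-balance = solve-∀

premises-smaller : ∀ {Ps} {S : Sequent V} → G4KM Ps S → All (λ P → size P < size S) Ps
premises-smaller ⊥L  = []
premises-smaller IdP = []
premises-smaller (∧L {Γ} {Δ} {φ} {ψ}) =
  slack (∧L-balance (excess φ) (excess ψ) (total Γ) (total Δ)) ∷
  []
premises-smaller (∧R {Γ} {Δ} {φ} {ψ}) =
  slack (∧R₁-balance (excess φ) (excess ψ) (total Γ) (total Δ)) ∷
  slack (∧R₂-balance (excess φ) (excess ψ) (total Γ) (total Δ)) ∷
  []
premises-smaller (∨L {Γ} {Δ} {φ} {ψ}) =
  slack (∨L₁-balance (excess φ) (excess ψ) (total Γ) (total Δ)) ∷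
  slack (∨L₂-balance (excess φ) (excess ψ) (total Γ) (total Δ)) ∷
  []
premises-smaller (∨R {Γ} {Δ} {φ} {ψ}) =
  slack (∨R-balance (excess φ) (excess ψ) (total Γ) (total Δ)) ∷
  []
premises-smaller (∧→L {Γ} {Δ} {φ} {ψ} {χ}) =
  -- Currying trades a factor 4 for a factor 3: the product of the three weights has coefficient 12
  -- before and 9 after. Hence `∧` weighs more than `⊃`.
  slack (∧→L-balance (excess φ) (excess ψ) (excess χ) (total Γ) (total Δ)) ∷
  []
premises-smaller (∨→L {Γ} {Δ} {φ} {ψ} {χ}) =
  -- The premise duplicates `χ`. A multiplicative weight pays for this, an additive one would not.
  slack (∨→L-balance (excess φ) (excess ψ) (excess χ) (total Γ) (total Δ)) ∷
  []
premises-smaller (p→L {Γ} {Δ} {p} {φ}) =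
  slack (p→L-balance (excess φ) (total Γ) (total Δ)) ∷
  []
premises-smaller (□R {Γ} {Δ} {φ}) =
  -- With factor c for a box, `φ` counts c + 2 times above the line and 2c times below, so c = 3 is
  -- the least choice.
  ≤-<-trans (modal-≤ (□ φ ∷ []) φ Γ Δ)
    (slack (□R-balance (excess φ) (total Γ) (total Δ))) ∷
  []
premises-smaller (□→L {Γ} {Δ} {φ} {ψ}) =
  ≤-<-trans (modal-≤ (□ φ ∷ ψ ∷ []) φ Γ Δ)
    (slack (□→L₁-balance (excess φ) (excess ψ) (total Γ) (total Δ))) ∷
  slack (□→L₂-balance (excess φ) (excess ψ) (total Γ) (total Δ)) ∷
  []
premises-smaller (→R {Γ} {Δ} {φ} {ψ}) =
  slack (→R-balance (excess φ) (excess ψ) (total Γ) (total Δ)) ∷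
  ≤-<-trans (modal-≤ (φ ∷ []) ψ Γ Δ)
    (slack (→R-balance (excess φ) (excess ψ) (total Γ) (total Δ))) ∷
  []
premises-smaller (→→L {Γ} {Δ} {φ} {χ} {ψ}) =
  slack (→→L₁-balance (excess φ) (excess χ) (excess ψ) (total Γ) (total Δ)) ∷
  ≤-<-trans (modal-≤ (χ ⊃ ψ ∷ φ ∷ []) χ Γ Δ)
    (slack (→→L₁-balance (excess φ) (excess χ) (excess ψ) (total Γ) (total Δ))) ∷
  slack (→→L₃-balance (excess φ) (excess χ) (excess ψ) (total Γ) (total Δ)) ∷
  []

-- The decision procedure

module _ (_≟_ : DecidableEquality V) where

  -- The recursion is structural in the accessibility proof, so the recursive call may sit inside
  -- the predicate handed to the searches.
  provable-acc? : (S : Sequent V) → Acc _<_ (size S) → Dec (Provable S)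
  provable-acc? S (acc smaller) =
    map′ to from (≈-search? (inference? _≟_ smallProvable?) S)
    where
    -- The size condition makes the predicate decidable at every sequent.
    SmallProvable = λ T → size T < size S × Provable T

    smallProvable? : Decidable SmallProvable
    smallProvable? T with size T <? size S
    ... | yes T<S = map′ (T<S ,_) proj₂ (provable-acc? T (smaller T<S))
    ... | no T≮S  = no λ (T<S , _) → T≮S T<S

    Search = ∃ λ S′ → S ≈ S′ × ∃ λ Ps → G4KM Ps S′ × All SmallProvable Ps

    to : Search → Provable S
    to (_ , S≈S′ , _ , r , ps) = infer S≈S′ r (All.map proj₂ ps)

    from : Provable S → Search
    from (infer S≈S′ r ps) =
      -- The size condition excludes no derivation: `premises-smaller` bounds the premises by the
      -- size of `S′`, which equals that of `S`.
      _ , S≈S′ , _ , r ,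
      All.zip (All.map (λ {T} → subst (size T <_) (sym (size-≈ S≈S′)))
                       (premises-smaller r) , ps)

proposition2 : (V : Set) → DecidableEquality V → V ↔ ℕ →
    (S : Sequent V) → Dec (Provable S)
proposition2 V _≟_ _ S = provable-acc? _≟_ S (<-wellFounded (size S))
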